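{- The satisfiability problem for $\mathrm{AUF}_1^{ - }$ (given an $\mathrm{AUF}_1^{ - }$ sentence, decide whether it has a model) is decidable.
   Context: Signatures are purely relational (no constants, no function symbols), and formulas do not use equality. For a relational signature $\sigma$, the $\sigma$-formulas of the logic $\mathrm{AUF}_1$ form the smallest set $\mathcal{F}$ such that: (1) every $\sigma$-atom using at most one variable is in $\mathcal{F}$; (2) $\mathcal{F}$ is closed under Boolean connectives; (3) if $\phi(x_0,\dots,x_k)$ is a Boolean combination of formulas of $\mathcal{F}$ with free variables among $x_0,\dots,x_k$ and of $\sigma$-atoms whose set of variables is exactly $\{x_0,\dots,x_k\}$ (in any order, possibly with repetitions), then $Q_0x_0\dots Q_kx_k\,\phi$ and $Q_1x_1\dots Q_kx_k\,\phi$ are in $\mathcal{F}$, where each $Q_i\in\{\exists,\forall\}$. The fragment $\mathrm{AUF}_1^{ - }$ consists of those $\mathrm{AUF}_1$ formulas that are in negation normal form (negation is applied only to atoms, the only other connectives being $\wedge$ and $\vee$) and in which every block of quantifiers introduced by clause (3) either consists only of universal quantifiers or has its last quantifier $Q_k$ existential. -}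

module Defs where

open import Data.List using (List; []; _∷_; _++_; filter; foldr; last; map)
open import Data.List.Membership.Propositional using (_∈_)
open import Data.List.Relation.Binary.BagAndSetEquality using (_∼[_]_; set)
open import Data.List.Relation.Binary.Subset.Propositional using (_⊆_)
open import Data.List.Relation.Unary.All using (All)
open import Data.List.Relation.Unary.Unique.Propositional using (Unique)
open import Data.Maybe using (just)
open import Data.Nat using (ℕ)
open import Data.Nat.Properties using (_≟_)
open import Data.Product using (Σ-syntax; _×_; _,_; proj₁; proj₂)
open import Data.Sum using (_⊎_)
open import Data.Unit using (⊤)
open import Data.Vec as Vec using (Vec; toList)
open import Relation.Binary.Definitions using (DecidableEquality)
open import Relation.Binary.PropositionalEquality using (_≡_)
open import Relation.Nullary using (¬_; ¬?; yes; no)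

-- Equality of symbols is decidable because signatures are part of the input:
-- without it even the satisfiability of ∀x (P x ∧ ¬ Q x) could not be decided.
record Signature : Set₁ where
  field
    Symbol  : Set
    _≟ˢ_    : DecidableEquality Symbol
    arity   : Symbol → ℕ

open Signature public using (Symbol; arity)

Var : Set
Var = ℕ

data Quantifier : Set where
  univ exis : Quantifier

infix  9 ¬ᶠ_
infixr 8 _∧ᶠ_
infixr 7 _∨ᶠ_

data Formula (σ : Signature) : Set where
  atom      : (R : Symbol σ) → Vec Var (arity σ R) → Formula σ
  ¬ᶠ_       : Formula σ → Formula σ
  _∧ᶠ_ _∨ᶠ_ : Formula σ → Formula σ → Formula σ
  quant     : Quantifier → Var → Formula σ → Formula σ

fv : ∀ {σ} → Formula σ → List Var
fv (atom R xs)   = toList xs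
fv (¬ᶠ φ)        = fv φ
fv (φ ∧ᶠ ψ)      = fv φ ++ fv ψ
fv (φ ∨ᶠ ψ)      = fv φ ++ fv ψ
fv (quant q x φ) = filter (λ y → ¬? (y ≟ x)) (fv φ)

Sentence : ∀ {σ} → Formula σ → Set
Sentence φ = fv φ ≡ []

Prefix : Set
Prefix = List (Quantifier × Var)

quantifiers : Prefix → List Quantifier
quantifiers = map proj₁

variables : Prefix → List Var
variables = map proj₂

block : ∀ {σ} → Prefix → Formula σ → Formula σ
block qs φ = foldr (λ (q , x) → quant q x) φ qs

-- In the two block rules the prefix qs is Q₁x₁ … Qₖxₖ, and x₀ is either
-- quantified in front of it or left free.  In BoolComb X, the list X consists
-- of x₀, …, xₖ.
mutual
  data AUF₁ {σ : Signature} : Formula σ → Set where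
    atom   : ∀ {R xs} → (∀ {x y} → x ∈ toList xs → y ∈ toList xs → x ≡ y) →
             AUF₁ (atom R xs)
    ¬ᶠ_    : ∀ {φ} → AUF₁ φ → AUF₁ (¬ᶠ φ)
    _∧ᶠ_   : ∀ {φ ψ} → AUF₁ φ → AUF₁ ψ → AUF₁ (φ ∧ᶠ ψ)
    _∨ᶠ_   : ∀ {φ ψ} → AUF₁ φ → AUF₁ ψ → AUF₁ (φ ∨ᶠ ψ)
    closed : ∀ q₀ x₀ qs {φ} → Unique (x₀ ∷ variables qs) →
             BoolComb (x₀ ∷ variables qs) φ → AUF₁ (block ((q₀ , x₀) ∷ qs) φ)
    open₁  : ∀ x₀ qs {φ} → Unique (x₀ ∷ variables qs) →
             BoolComb (x₀ ∷ variables qs) φ → AUF₁ (block qs φ)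

  data BoolComb {σ : Signature} (X : List Var) : Formula σ → Set where
    auf₁ : ∀ {φ} → AUF₁ φ → fv φ ⊆ X → BoolComb X φ
    atom : ∀ {R xs} → toList xs ∼[ set ] X → BoolComb X (atom R xs)
    ¬ᶠ_  : ∀ {φ} → BoolComb X φ → BoolComb X (¬ᶠ φ)
    _∧ᶠ_ : ∀ {φ ψ} → BoolComb X φ → BoolComb X ψ → BoolComb X (φ ∧ᶠ ψ)
    _∨ᶠ_ : ∀ {φ ψ} → BoolComb X φ → BoolComb X ψ → BoolComb X (φ ∨ᶠ ψ)

-- The empty prefix, possible only in open₁ where it changes nothing, counts as
-- purely universal.
AdmissibleBlock : List Quantifier → Set
AdmissibleBlock qs = All (_≡ univ) qs ⊎ last qs ≡ just exis

mutual
  AdmissibleBlocks : ∀ {σ} {φ : Formula σ} → AUF₁ φ → Set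
  AdmissibleBlocks (atom _)            = ⊤
  AdmissibleBlocks (¬ᶠ d)              = AdmissibleBlocks d
  AdmissibleBlocks (d ∧ᶠ e)            = AdmissibleBlocks d × AdmissibleBlocks e
  AdmissibleBlocks (d ∨ᶠ e)            = AdmissibleBlocks d × AdmissibleBlocks e
  AdmissibleBlocks (closed q₀ _ qs _ b) =
    AdmissibleBlock (q₀ ∷ quantifiers qs) × AdmissibleBlocksᵇ b
  AdmissibleBlocks (open₁ _ qs _ b)    =
    AdmissibleBlock (quantifiers qs) × AdmissibleBlocksᵇ b

  AdmissibleBlocksᵇ : ∀ {σ X} {φ : Formula σ} → BoolComb X φ → Set
  AdmissibleBlocksᵇ (auf₁ d _) = AdmissibleBlocks d
  AdmissibleBlocksᵇ (atom _)   = ⊤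
  AdmissibleBlocksᵇ (¬ᶠ b)     = AdmissibleBlocksᵇ b
  AdmissibleBlocksᵇ (b ∧ᶠ c)   = AdmissibleBlocksᵇ b × AdmissibleBlocksᵇ c
  AdmissibleBlocksᵇ (b ∨ᶠ c)   = AdmissibleBlocksᵇ b × AdmissibleBlocksᵇ c

data NNF {σ : Signature} : Formula σ → Set where
  atom  : ∀ {R xs} → NNF (atom R xs)
  ¬atom : ∀ {R xs} → NNF (¬ᶠ atom R xs)
  _∧ᶠ_  : ∀ {φ ψ} → NNF φ → NNF ψ → NNF (φ ∧ᶠ ψ)
  _∨ᶠ_  : ∀ {φ ψ} → NNF φ → NNF ψ → NNF (φ ∨ᶠ ψ)
  quant : ∀ {q x φ} → NNF φ → NNF (quant q x φ)

-- Which quantifiers form a block is determined by a derivation, not by the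
-- formula: ∃x₀ ∀x₁ φ can be one block or two nested ones.
AUF₁⁻ : ∀ {σ} → Formula σ → Set
AUF₁⁻ φ = NNF φ × (Σ[ d ∈ AUF₁ φ ] AdmissibleBlocks d)

record Structure (σ : Signature) : Set₁ where
  field
    Domain   : Set
    nonempty : Domain
    rel      : (R : Symbol σ) → Vec Domain (arity σ R) → Set

open Structure public using (Domain; rel)

_[_↦_] : ∀ {D : Set} → (Var → D) → Var → D → Var → D
(ρ [ x ↦ a ]) y with y ≟ x
... | yes _ = a
... | no  _ = ρ y

infix 4 _,_⊨_

_,_⊨_ : ∀ {σ} (𝔄 : Structure σ) → (Var → Domain 𝔄) → Formula σ → Set
𝔄 , ρ ⊨ atom R xs      = rel 𝔄 R (Vec.map ρ xs)
𝔄 , ρ ⊨ ¬ᶠ φ           = ¬ (𝔄 , ρ ⊨ φ)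
𝔄 , ρ ⊨ φ ∧ᶠ ψ         = (𝔄 , ρ ⊨ φ) × (𝔄 , ρ ⊨ ψ)
𝔄 , ρ ⊨ φ ∨ᶠ ψ         = (𝔄 , ρ ⊨ φ) ⊎ (𝔄 , ρ ⊨ ψ)
𝔄 , ρ ⊨ quant univ x φ = (a : Domain 𝔄) → 𝔄 , ρ [ x ↦ a ] ⊨ φ
𝔄 , ρ ⊨ quant exis x φ = Σ[ a ∈ Domain 𝔄 ] (𝔄 , ρ [ x ↦ a ] ⊨ φ)

Satisfiable : ∀ {σ} → Formula σ → Set₁
Satisfiable {σ} φ = Σ[ 𝔄 ∈ Structure σ ] (∀ ρ → 𝔄 , ρ ⊨ φ)

{-# OPTIONS --safe #-}
module Submission where

-- Satisfiability is equivalent to the existence of a certificate from a finite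
-- list: a truth table G over representatives of the 1-types, in which every
-- universal block holds, together with a winning strategy for the game in which
-- a block is played on types only and which ends with a table that describes the
-- chosen elements.  A model yields a certificate up to double negation, which
-- suffices because certificates are decidable.
--
-- Conversely, since equality is absent and the last quantifier of a block that is
-- not universal is existential, each play can end with a fresh element.  So the
-- model consists of terms in which an element records the elements chosen before
-- it and the table reached at the end of the play.  All atoms on a set of elements
-- are read off one table: that of the member whose recorded elements cover the
-- set (there is at most one, as terms are well-founded), and otherwise G.  Hence
-- plays do not interfere, and universal blocks hold because they hold in every
-- table.

open import Defs
open import Data.Bool using (Bool; true; false; not; _∧_; _∨_; if_then_else_)
import Data.Bool.Properties as Bool
open import Data.Empty using (⊥-elim)
open import Data.Fin using (Fin; zero; suc)
import Data.Fin.Properties as Fin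
open import Data.List using (List; []; _∷_; _++_; concatMap; drop; head; length; lookup; map; take; allFin; cartesianProductWith)
import Data.List as List
open import Data.List.Membership.Propositional using (_∈_; _∉_; find; lose)
open import Data.List.Membership.Propositional.Properties
open import Data.List.Relation.Binary.BagAndSetEquality using (_∼[_]_; set)
open import Data.List.Relation.Binary.Subset.Propositional using (_⊆_)
open import Data.List.Relation.Unary.All as All using (All; []; _∷_)
import Data.List.Relation.Unary.All.Properties as All
open import Data.List.Relation.Unary.Any as Any using (Any; here; there)
import Data.List.Relation.Unary.Any.Properties as Any
open import Data.List.Relation.Unary.AllPairs using ([]; _∷_)
open import Data.List.Relation.Unary.Unique.Propositional using (Unique)
open import Data.Maybe using (Maybe; just; nothing)
open import Data.Nat using (ℕ; zero; suc; _+_; _≤_; _<_; s≤s)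
import Data.Nat.Properties as ℕ
open import Data.Product using (Σ-syntax; ∃-syntax; _×_; _,_; proj₁; proj₂)
import Data.Product.Properties as Product
open import Data.Sum using (_⊎_; inj₁; inj₂; [_,_]′)
import Data.Sum.Properties as Sum
open import Data.Vec as Vec using (Vec; []; _∷_; toList; fromList; replicate)
import Data.Vec.Functional as Vector
import Data.Vec.Properties as Vec
open import Function using (_∘_; id; const; _⇔_; mk⇔; Equivalence)
open import Relation.Binary.Definitions using (DecidableEquality)
open import Relation.Binary.PropositionalEquality
open import Relation.Nullary using (¬_; Dec; yes; no; does; contradiction)
open import Relation.Nullary.Decidable using (map′; _×-dec_; _→-dec_; decidable-stable; ¬¬-excluded-middle)
open import Relation.Nullary.Negation using (¬¬-map)

open Equivalence using (to; from)

-- Double negation, and small facts on Booleans, lists and vectors.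

-- Makes `do` blocks work for double negation, so that classical case distinctions are available on
-- the way to a decidable goal.
_>>=_ : {A B : Set} → ¬ ¬ A → (A → ¬ ¬ B) → ¬ ¬ B
(m >>= f) k = m λ a → f a k

¬¬-η : {A : Set} → A → ¬ ¬ A
¬¬-η a ¬a = ¬a a

-- Double-negation shift for a finite range: the double negations are removed one index at a time.
¬¬-∀-Fin : ∀ {n} {P : Fin n → Set} → (∀ i → ¬ ¬ P i) → ¬ ¬ (∀ i → P i)
¬¬-∀-Fin {zero}  h k = k λ ()
¬¬-∀-Fin {suc n} h = do
  p ← h zero
  ps ← ¬¬-∀-Fin (h ∘ suc)
  ¬¬-η λ { zero → p ; (suc i) → ps i }

bool-ext : ∀ {P : Set} {b c : Bool} → (b ≡ true ⇔ P) → (c ≡ true ⇔ P) → b ≡ c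
bool-ext {b = true}  {true}  _ _ = refl
bool-ext {b = false} {false} _ _ = refl
bool-ext {b = true}  {false} e f = sym (from f (to e refl))
bool-ext {b = false} {true}  e f = from e (to f refl)

∧-true : ∀ {b c} → b ∧ c ≡ true → b ≡ true × c ≡ true
∧-true {true} {true} _ = refl , refl

∨-true : ∀ {b c} → b ∨ c ≡ true → b ≡ true ⊎ c ≡ true
∨-true {true}  _ = inj₁ refl
∨-true {false} e = inj₂ e

-- Turns membership into a number, which is how an element of the model records a table.
∈⇒nth : ∀ {A : Set} {x : A} {xs} → x ∈ xs → ∃[ n ] head (drop n xs) ≡ just x
∈⇒nth (here refl) = 0 , refl
∈⇒nth (there x∈xs) = let n , eq = ∈⇒nth x∈xs in suc n , eq

∨-introˡ : ∀ {b c} → b ≡ true → b ∨ c ≡ true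
∨-introˡ refl = refl

∨-introʳ : ∀ {b c} → c ≡ true → b ∨ c ≡ true
∨-introʳ {b} refl = Bool.∨-zeroʳ b

not-true : ∀ {b} → not b ≡ true → b ≢ true
not-true () refl

lookup-injective : ∀ {A : Set} {xs : List A} → Unique xs → ∀ i j → lookup xs i ≡ lookup xs j → i ≡ j
lookup-injective (x∉ ∷ u) zero    zero    eq = refl
lookup-injective (x∉ ∷ u) zero    (suc j) eq = ⊥-elim (All.lookup x∉ (∈-lookup j) eq)
lookup-injective (x∉ ∷ u) (suc i) zero    eq = ⊥-elim (All.lookup x∉ (∈-lookup i) (sym eq))
lookup-injective (x∉ ∷ u) (suc i) (suc j) eq = cong suc (lookup-injective u i j eq)

module _ {A B : Set} where

  map-cong-∈ : ∀ {n} {f g : A → B} (xs : Vec A n) → (∀ {x} → x ∈ toList xs → f x ≡ g x) →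
               Vec.map f xs ≡ Vec.map g xs
  map-cong-∈ []       h = refl
  map-cong-∈ (x ∷ xs) h = cong₂ _∷_ (h (here refl)) (map-cong-∈ xs (h ∘ there))

  map-const : ∀ {n} {f : A → B} {b} (xs : Vec A n) → (∀ {x} → x ∈ toList xs → f x ≡ b) →
              Vec.map f xs ≡ replicate n b
  map-const []       h = refl
  map-const (x ∷ xs) h = cong₂ _∷_ (h (here refl)) (map-const xs (h ∘ there))

allVecs : ∀ m n → List (Vec (Fin m) n)
allVecs m zero    = [] ∷ []
allVecs m (suc n) = cartesianProductWith _∷_ (allFin m) (allVecs m n)

∈-allVecs : ∀ {m n} (v : Vec (Fin m) n) → v ∈ allVecs m n
∈-allVecs []      = here refl
∈-allVecs (i ∷ v) = ∈-cartesianProductWith⁺ _∷_ (∈-allFin i) (∈-allVecs v)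

-- Boolean valuations of a finite list of keys.

module Valuations {K : Set} (_≟_ : DecidableEquality K) where

  override : K → Bool → (K → Bool) → K → Bool
  override k b f k′ = if does (k′ ≟ k) then b else f k′

  -- A finite stand-in for all Boolean functions on `ks`; outside the list the value is `false`.
  valuations : List K → List (K → Bool)
  valuations []       = const false ∷ []
  valuations (k ∷ ks) = concatMap (λ f → override k true f ∷ override k false f ∷ []) (valuations ks)

  override-∈ : ∀ {k f ks} b → f ∈ valuations ks → override k b f ∈ valuations (k ∷ ks)
  override-∈ true  f∈ = ∈-concatMap⁺ (λ f → override _ true f ∷ override _ false f ∷ [])
    (lose f∈ (here refl))
  override-∈ false f∈ = ∈-concatMap⁺ (λ f → override _ true f ∷ override _ false f ∷ [])
    (lose f∈ (there (here refl)))

  Decides : (K → Bool) → (K → Set) → K → Set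
  Decides f P k = f k ≡ true ⇔ P k

  override-decides : ∀ {P k ks b f} → (b ≡ true ⇔ P k) → (∀ {k′} → k′ ∈ ks → Decides f P k′) →
                     ∀ {k′} → k′ ∈ k ∷ ks → Decides (override k b f) P k′
  override-decides {k = k} e h {k′} k′∈ with k′ ≟ k
  ... | yes refl = e
  override-decides e h (here refl)  | no k≢k = contradiction refl k≢k
  override-decides e h (there k′∈)  | no _   = h k′∈

  -- One classical case distinction is made for each key.
  valuation-of : ∀ (P : K → Set) ks →
                 ¬ ¬ (Σ[ f ∈ (K → Bool) ] f ∈ valuations ks × (∀ {k} → k ∈ ks → Decides f P k))
  valuation-of P []       = ¬¬-η (const false , here refl , λ ())
  valuation-of P (k ∷ ks) = do
    f , f∈ , h ← valuation-of P ks
    d ← ¬¬-excluded-middle {A = P k}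
    ¬¬-η (decide f f∈ h d)
    where
    decide : ∀ f → f ∈ valuations ks → (∀ {k′} → k′ ∈ ks → Decides f P k′) → Dec (P k) →
             Σ[ f ∈ (K → Bool) ] f ∈ valuations (k ∷ ks) × (∀ {k′} → k′ ∈ k ∷ ks → Decides f P k′)
    decide f f∈ h (yes p) = override k true f , override-∈ {ks = ks} true f∈ ,
                            override-decides (mk⇔ (const p) (const refl)) h
    decide f f∈ h (no ¬p) = override k false f , override-∈ {ks = ks} false f∈ ,
                            override-decides (mk⇔ (λ ()) (⊥-elim ∘ ¬p)) h

-- Quantifiers, assignments and prefixes.

infix 4 _≟ᑫ_

_≟ᑫ_ : DecidableEquality Quantifier
univ ≟ᑫ univ = yes refl
univ ≟ᑫ exis = no λ ()
exis ≟ᑫ univ = no λ ()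
exis ≟ᑫ exis = yes refl

updated : ∀ {D : Set} (ρ : Var → D) x a → (ρ [ x ↦ a ]) x ≡ a
updated ρ x a with x ℕ.≟ x
... | yes _  = refl
... | no x≢x = contradiction refl x≢x

updated-other : ∀ {D : Set} (ρ : Var → D) {x y} a → y ≢ x → (ρ [ x ↦ a ]) y ≡ ρ y
updated-other ρ {x} {y} a y≢x with y ℕ.≟ x
... | yes y≡x = contradiction y≡x y≢x
... | no _    = refl

update-∘ : ∀ {D E : Set} (f : D → E) {ρ : Var → E} {ρ′ : Var → D} →
           (∀ y → ρ y ≡ f (ρ′ y)) → ∀ x {a b} → a ≡ f b →
           ∀ y → (ρ [ x ↦ a ]) y ≡ f ((ρ′ [ x ↦ b ]) y)
update-∘ f h x eq y with y ℕ.≟ x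
... | yes _ = eq
... | no _  = h y

Uniform : ∀ {n} → Vec Var n → Set
Uniform xs = ∀ {x y} → x ∈ toList xs → y ∈ toList xs → x ≡ y

uniform : ∀ {x₀ : Var} {ys} {Q : Var → Set} → (∀ {y} → y ∈ ys → y ≡ x₀ × Q y) →
          ∀ {y z} → y ∈ ys → z ∈ ys → y ≡ z
uniform h y∈ z∈ = trans (proj₁ (h y∈)) (sym (proj₁ (h z∈)))

assign : ∀ {D : Set} → (Var → D) → Prefix → (Var → D) → Var → D
assign ρ []             g = ρ
assign ρ ((_ , x) ∷ qs) g = assign (ρ [ x ↦ g x ]) qs g

-- The disjunction is the invariant of the recursion: either `y` is still to be assigned, or it
-- already has the value `g y`, which survives later assignments because they also follow `g`.
assign-≡ : ∀ {D : Set} {ρ : Var → D} qs g {y} → y ∈ variables qs ⊎ ρ y ≡ g y → assign ρ qs g y ≡ g y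
assign-≡ [] g (inj₂ eq) = eq
assign-≡ {ρ = ρ} ((_ , x) ∷ qs) g {y} h with y ℕ.≟ x
... | yes refl = assign-≡ qs g (inj₂ (updated ρ y (g y)))
... | no y≢x   = assign-≡ qs g (skip h)
  where
  skip : y ∈ x ∷ variables qs ⊎ ρ y ≡ g y → y ∈ variables qs ⊎ (ρ [ x ↦ g x ]) y ≡ g y
  skip (inj₁ (here y≡x)) = contradiction y≡x y≢x
  skip (inj₁ (there y∈)) = inj₁ y∈
  skip (inj₂ eq)         = inj₂ (trans (updated-other ρ (g x) y≢x) eq)

-- An inductive form of the condition on the last quantifier, so that `play` can recurse on the
-- prefix and stop at the final existential move.
data EndsInExis : Prefix → Set where
  last : ∀ x → EndsInExis ((exis , x) ∷ [])
  _∷_  : ∀ p {qs} → EndsInExis qs → EndsInExis (p ∷ qs)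

endsInExis : ∀ qs → List.last (quantifiers qs) ≡ just exis → EndsInExis qs
endsInExis ((exis , x) ∷ [])     _  = last x
endsInExis (p ∷ qs@(_ ∷ _)) eq = p ∷ endsInExis qs eq

-- Formulas: decidable equality, coincidence, free variables of blocks.

module _ {σ : Signature} where

  infix 4 _≟ᶠ_

  -- Formulas are keys of truth tables, so their equality has to be decided.
  _≟ᶠ_ : DecidableEquality (Formula σ)
  atom R xs ≟ᶠ atom S ys = map′ (λ { refl → refl }) (λ { refl → refl })
    (Product.≡-dec (Signature._≟ˢ_ σ) (Vec.≡-dec ℕ._≟_) (R , xs) (S , ys))
  (¬ᶠ φ) ≟ᶠ (¬ᶠ ψ) = map′ (cong ¬ᶠ_) (λ { refl → refl }) (φ ≟ᶠ ψ)
  (φ ∧ᶠ ψ) ≟ᶠ (φ′ ∧ᶠ ψ′) = map′ (λ { (refl , refl) → refl }) (λ { refl → refl , refl })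
    ((φ ≟ᶠ φ′) ×-dec (ψ ≟ᶠ ψ′))
  (φ ∨ᶠ ψ) ≟ᶠ (φ′ ∨ᶠ ψ′) = map′ (λ { (refl , refl) → refl }) (λ { refl → refl , refl })
    ((φ ≟ᶠ φ′) ×-dec (ψ ≟ᶠ ψ′))
  quant q x φ ≟ᶠ quant r y ψ = map′ (λ { (refl , refl , refl) → refl }) (λ { refl → refl , refl , refl })
    ((q ≟ᑫ r) ×-dec (x ℕ.≟ y) ×-dec (φ ≟ᶠ ψ))
  atom _ _ ≟ᶠ (¬ᶠ _)      = no λ ()
  atom _ _ ≟ᶠ (_ ∧ᶠ _)    = no λ ()
  atom _ _ ≟ᶠ (_ ∨ᶠ _)    = no λ ()
  atom _ _ ≟ᶠ quant _ _ _ = no λ ()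
  (¬ᶠ _) ≟ᶠ atom _ _      = no λ ()
  (¬ᶠ _) ≟ᶠ (_ ∧ᶠ _)      = no λ ()
  (¬ᶠ _) ≟ᶠ (_ ∨ᶠ _)      = no λ ()
  (¬ᶠ _) ≟ᶠ quant _ _ _   = no λ ()
  (_ ∧ᶠ _) ≟ᶠ atom _ _    = no λ ()
  (_ ∧ᶠ _) ≟ᶠ (¬ᶠ _)      = no λ ()
  (_ ∧ᶠ _) ≟ᶠ (_ ∨ᶠ _)    = no λ ()
  (_ ∧ᶠ _) ≟ᶠ quant _ _ _ = no λ ()
  (_ ∨ᶠ _) ≟ᶠ atom _ _    = no λ ()
  (_ ∨ᶠ _) ≟ᶠ (¬ᶠ _)      = no λ ()
  (_ ∨ᶠ _) ≟ᶠ (_ ∧ᶠ _)    = no λ ()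
  (_ ∨ᶠ _) ≟ᶠ quant _ _ _ = no λ ()
  quant _ _ _ ≟ᶠ atom _ _ = no λ ()
  quant _ _ _ ≟ᶠ (¬ᶠ _)   = no λ ()
  quant _ _ _ ≟ᶠ (_ ∧ᶠ _) = no λ ()
  quant _ _ _ ≟ᶠ (_ ∨ᶠ _) = no λ ()

  update-cong : ∀ {D : Set} {ρ ρ′ : Var → D} (φ : Formula σ) x {a} →
                (∀ {y} → y ∈ fv (quant univ x φ) → ρ y ≡ ρ′ y) →
                ∀ {y} → y ∈ fv φ → (ρ [ x ↦ a ]) y ≡ (ρ′ [ x ↦ a ]) y
  update-cong φ x h {y} y∈ with y ℕ.≟ x
  ... | yes _  = refl
  ... | no y≢x = h (∈-filter⁺ _ y∈ y≢x)

  coincidence : (𝔄 : Structure σ) (φ : Formula σ) {ρ ρ′ : Var → Domain 𝔄} →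
                (∀ {y} → y ∈ fv φ → ρ y ≡ ρ′ y) → 𝔄 , ρ ⊨ φ → 𝔄 , ρ′ ⊨ φ
  coincidence 𝔄 (atom R xs) h = subst (rel 𝔄 R) (map-cong-∈ xs h)
  coincidence 𝔄 (¬ᶠ φ) h ¬p p = ¬p (coincidence 𝔄 φ (sym ∘ h) p)
  coincidence 𝔄 (φ ∧ᶠ ψ) h (p , q) =
    coincidence 𝔄 φ (h ∘ ∈-++⁺ˡ) p , coincidence 𝔄 ψ (h ∘ ∈-++⁺ʳ (fv φ)) q
  coincidence 𝔄 (φ ∨ᶠ ψ) h (inj₁ p) = inj₁ (coincidence 𝔄 φ (h ∘ ∈-++⁺ˡ) p)
  coincidence 𝔄 (φ ∨ᶠ ψ) h (inj₂ q) = inj₂ (coincidence 𝔄 ψ (h ∘ ∈-++⁺ʳ (fv φ)) q)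
  coincidence 𝔄 (quant univ x φ) h p a = coincidence 𝔄 φ (update-cong φ x h) (p a)
  coincidence 𝔄 (quant exis x φ) h (a , p) = a , coincidence 𝔄 φ (update-cong φ x h) p

  fv-block : ∀ qs {ψ : Formula σ} {y} → y ∈ fv (block qs ψ) → y ∈ fv ψ × y ∉ variables qs
  fv-block []             y∈ = y∈ , λ ()
  fv-block ((q , x) ∷ qs) y∈ with ∈-filter⁻ _ {xs = fv (block qs _)} y∈
  ... | y∈′ , y≢x with fv-block qs y∈′
  ...   | y∈ψ , y∉ = y∈ψ , λ { (here y≡x) → y≢x y≡x ; (there y∈qs) → y∉ y∈qs }

  -- A common form of the three conditions of AUF₁⁻; x₀ is the variable that may
  -- be free in the block.
  mutual
    data Normal : Formula σ → Set where
      atom  : ∀ {R xs} → Uniform xs → Normal (atom R xs)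
      ¬atom : ∀ {R xs} → Uniform xs → Normal (¬ᶠ atom R xs)
      _∧ᶠ_  : ∀ {φ ψ} → Normal φ → Normal ψ → Normal (φ ∧ᶠ ψ)
      _∨ᶠ_  : ∀ {φ ψ} → Normal φ → Normal ψ → Normal (φ ∨ᶠ ψ)
      blk   : ∀ {X ψ} p qs x₀ → AdmissibleBlock (quantifiers (p ∷ qs)) →
              x₀ ∈ X → variables (p ∷ qs) ⊆ X → X ⊆ x₀ ∷ variables (p ∷ qs) →
              (∀ {y} → y ∈ fv (block (p ∷ qs) ψ) → y ≡ x₀ × y ∉ variables (p ∷ qs)) →
              Matrix X ψ → Normal (block (p ∷ qs) ψ)

    data Matrix (X : List Var) : Formula σ → Set where
      normal : ∀ {φ} → Normal φ → fv φ ⊆ X → Matrix X φ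
      atom   : ∀ {R xs} → toList xs ∼[ set ] X → Matrix X (atom R xs)
      ¬atom  : ∀ {R xs} → toList xs ∼[ set ] X → Matrix X (¬ᶠ atom R xs)
      _∧ᶠ_   : ∀ {φ ψ} → Matrix X φ → Matrix X ψ → Matrix X (φ ∧ᶠ ψ)
      _∨ᶠ_   : ∀ {φ ψ} → Matrix X φ → Matrix X ψ → Matrix X (φ ∨ᶠ ψ)

  -- From derivations to normal forms.

  ∼[x]⇒Uniform : ∀ {x n} {xs : Vec Var n} → toList xs ∼[ set ] (x ∷ []) → Uniform xs
  ∼[x]⇒Uniform s y∈ z∈ with to s y∈ | to s z∈
  ... | here refl | here refl = refl

  -- Serves `open₁` with the empty prefix: an atom whose set of variables is a singleton is an atom
  -- in one variable.
  matrix⇒normal : ∀ {x φ} → Matrix (x ∷ []) φ → Normal φ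
  matrix⇒normal (normal d _) = d
  matrix⇒normal (atom s)     = atom (∼[x]⇒Uniform s)
  matrix⇒normal (¬atom s)    = ¬atom (∼[x]⇒Uniform s)
  matrix⇒normal (b ∧ᶠ c)     = matrix⇒normal b ∧ᶠ matrix⇒normal c
  matrix⇒normal (b ∨ᶠ c)     = matrix⇒normal b ∨ᶠ matrix⇒normal c

  fv-BoolComb : ∀ {X φ} → BoolComb {σ} X φ → fv φ ⊆ X
  fv-BoolComb (auf₁ _ s) = s
  fv-BoolComb (atom s)   = to s
  fv-BoolComb (¬ᶠ b)     = fv-BoolComb b
  fv-BoolComb {φ = φ ∧ᶠ _} (b ∧ᶠ c) = [ fv-BoolComb b , fv-BoolComb c ]′ ∘ ∈-++⁻ (fv φ)
  fv-BoolComb {φ = φ ∨ᶠ _} (b ∨ᶠ c) = [ fv-BoolComb b , fv-BoolComb c ]′ ∘ ∈-++⁻ (fv φ)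

  NNF-block : ∀ qs {ψ : Formula σ} → NNF (block qs ψ) → NNF ψ
  NNF-block []       n         = n
  NNF-block (_ ∷ qs) (quant n) = NNF-block qs n

  -- A derivation of an atom may be wrapped in `open₁` with empty prefixes; the equation allows
  -- matching on it although its index is a `block`.
  AUF₁-atom : ∀ {φ R xs} → AUF₁ {σ} φ → φ ≡ atom R xs → Uniform xs
  AUF₁-atom (atom u) refl = u
  AUF₁-atom (open₁ x₀ [] _ (auf₁ d _)) eq = AUF₁-atom d eq
  AUF₁-atom (open₁ x₀ [] _ (atom s)) refl = ∼[x]⇒Uniform s

  mutual
    normalise : ∀ {φ : Formula σ} (d : AUF₁ φ) → NNF φ → AdmissibleBlocks d → Normal φ
    normalise (atom u) _ _ = atom u
    normalise (¬ᶠ d) ¬atom _ = ¬atom (AUF₁-atom d refl)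
    normalise (d ∧ᶠ e) (n ∧ᶠ m) (a , b) = normalise d n a ∧ᶠ normalise e m b
    normalise (d ∨ᶠ e) (n ∨ᶠ m) (a , b) = normalise d n a ∨ᶠ normalise e m b
    normalise (closed q₀ x₀ qs u b) n (a , ab) =
      -- A closed block has no free variable, so the first quantified variable can take the role of
      -- the free one.
      blk (q₀ , x₀) qs x₀ a (here refl) id there
        (λ y∈ → let y∈ψ , y∉ = fv-block ((q₀ , x₀) ∷ qs) y∈ in
                contradiction (fv-BoolComb b y∈ψ) y∉)
        (normaliseᵇ b (NNF-block ((q₀ , x₀) ∷ qs) n) ab)
    normalise (open₁ x₀ [] u b) n (_ , ab) = matrix⇒normal (normaliseᵇ b n ab)
    normalise (open₁ x₀ (p ∷ qs) u b) n (a , ab) =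
      blk p qs x₀ a (here refl) there id
        (λ y∈ → let y∈ψ , y∉ = fv-block (p ∷ qs) y∈ in
                x₀-only (fv-BoolComb b y∈ψ) y∉ , y∉)
        (normaliseᵇ b (NNF-block (p ∷ qs) n) ab)
      where
      x₀-only : ∀ {y} → y ∈ x₀ ∷ variables (p ∷ qs) → y ∉ variables (p ∷ qs) → y ≡ x₀
      x₀-only (here y≡x₀) _  = y≡x₀
      x₀-only (there y∈)  y∉ = contradiction y∈ y∉

    normaliseᵇ : ∀ {X} {φ : Formula σ} (b : BoolComb X φ) → NNF φ → AdmissibleBlocksᵇ b → Matrix X φ
    normaliseᵇ (auf₁ d s) n a = normal (normalise d n a) s
    normaliseᵇ (atom s) _ _ = atom s
    normaliseᵇ (¬ᶠ auf₁ d s) ¬atom _ = normal (¬atom (AUF₁-atom d refl)) s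
    normaliseᵇ (¬ᶠ atom s) ¬atom _ = ¬atom s
    normaliseᵇ (b ∧ᶠ c) (n ∧ᶠ m) (a , a′) = normaliseᵇ b n a ∧ᶠ normaliseᵇ c m a′
    normaliseᵇ (b ∨ᶠ c) (n ∨ᶠ m) (a , a′) = normaliseᵇ b n a ∨ᶠ normaliseᵇ c m a′

  -- A quantified subformula is treated as a predicate of its at most one free
  -- variable: a table records which of these claims are made.
  Predicate : Set
  Predicate = Symbol σ ⊎ Formula σ

  -- `fv` may list the same free variable several times; `take 1` makes the rank of a block 0 or 1.
  rank : Predicate → ℕ
  rank (inj₁ R) = arity σ R
  rank (inj₂ θ) = length (take 1 (fv θ))

  -- Truth tables and evaluation in them.

  Entry : ℕ → Set
  Entry m = Σ[ P ∈ Predicate ] Vec (Fin m) (rank P)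

  _≟ᵉ_ : ∀ {m} → DecidableEquality (Entry m)
  _≟ᵉ_ = Product.≡-dec (Sum.≡-dec (Signature._≟ˢ_ σ) _≟ᶠ_) (Vec.≡-dec Fin._≟_)

  Table : ℕ → Set
  Table m = Entry m → Bool

  eval : ∀ {m} → Table m → (Var → Fin m) → Formula σ → Bool
  eval M ρ (atom R xs) = M (inj₁ R , Vec.map ρ xs)
  eval M ρ (¬ᶠ φ)      = not (eval M ρ φ)
  eval M ρ (φ ∧ᶠ ψ)    = eval M ρ φ ∧ eval M ρ ψ
  eval M ρ (φ ∨ᶠ ψ)    = eval M ρ φ ∨ eval M ρ ψ
  eval M ρ θ@(quant _ _ _) = M (inj₂ θ , Vec.map ρ (fromList (take 1 (fv θ))))

  predicates : Formula σ → List Predicate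
  predicates (atom R xs)       = inj₁ R ∷ []
  predicates (¬ᶠ φ)            = predicates φ
  predicates (φ ∧ᶠ ψ)          = predicates φ ++ predicates ψ
  predicates (φ ∨ᶠ ψ)          = predicates φ ++ predicates ψ
  predicates θ@(quant _ _ φ)   = inj₂ θ ∷ predicates φ

  predicates-block : ∀ qs {ψ} → predicates ψ ⊆ predicates (block qs ψ)
  predicates-block []       = id
  predicates-block (_ ∷ qs) = there ∘ predicates-block qs

  mutual
    -- Collected from the normal form, since the formula alone does not determine how quantifiers
    -- are grouped into blocks.
    blocks : ∀ {φ : Formula σ} → Normal φ → List (Prefix × Formula σ)
    blocks (atom _)  = []
    blocks (¬atom _) = []
    blocks (d ∧ᶠ e)  = blocks d ++ blocks e
    blocks (d ∨ᶠ e)  = blocks d ++ blocks e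
    blocks (blk {ψ = ψ} p qs _ _ _ _ _ _ b) = (p ∷ qs , ψ) ∷ blocksᵐ b

    blocksᵐ : ∀ {X} {φ : Formula σ} → Matrix X φ → List (Prefix × Formula σ)
    blocksᵐ (normal d _) = blocks d
    blocksᵐ (atom _)     = []
    blocksᵐ (¬atom _)    = []
    blocksᵐ (b ∧ᶠ c)     = blocksᵐ b ++ blocksᵐ c
    blocksᵐ (b ∨ᶠ c)     = blocksᵐ b ++ blocksᵐ c

  Universal : Prefix → Set
  Universal qs = All (_≡ univ) (quantifiers qs)

  Forall : ∀ {m} → Table m → Prefix → Formula σ → (Var → Fin m) → Set
  Forall M []             ψ ρ = eval M ρ ψ ≡ true
  Forall M ((_ , x) ∷ qs) ψ ρ = ∀ i → Forall M qs ψ (ρ [ x ↦ i ])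

  Forall? : ∀ {m} (M : Table m) qs ψ ρ → Dec (Forall M qs ψ ρ)
  Forall? M []             ψ ρ = eval M ρ ψ Bool.≟ true
  Forall? M ((_ , x) ∷ qs) ψ ρ = Fin.all? λ i → Forall? M qs ψ (ρ [ x ↦ i ])

  forall-elim : ∀ {m} {M : Table m} qs {ψ ρ} → Forall M qs ψ ρ → ∀ g → eval M (assign ρ qs g) ψ ≡ true
  forall-elim []             e g = e
  forall-elim ((_ , x) ∷ qs) h g = forall-elim qs (h (g x)) g

  forall-intro : (𝔄 : Structure σ) → ∀ qs → Universal qs → ∀ {ψ : Formula σ} {ρ} →
                 (∀ ρ′ → (∀ {y} → y ∉ variables qs → ρ′ y ≡ ρ y) → 𝔄 , ρ′ ⊨ ψ) → 𝔄 , ρ ⊨ block qs ψ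
  forall-intro 𝔄 [] _ {ρ = ρ} h = h ρ λ _ → refl
  forall-intro 𝔄 ((univ , x) ∷ qs) (refl ∷ u) {ρ = ρ} h a = forall-intro 𝔄 qs u λ ρ′ ρ′≡ →
    h ρ′ λ y∉ → trans (ρ′≡ (y∉ ∘ there)) (updated-other ρ a (y∉ ∘ here))

  -- Certificates and their decidability.

  module Certificates (Ps : List Predicate) (Bs : List (Prefix × Formula σ)) where

    entries : ∀ m → List (Entry m)
    entries m = concatMap (λ P → map (P ,_) (allVecs m (rank P))) Ps

    ∈-entries : ∀ {m P} → P ∈ Ps → (v : Vec (Fin m) (rank P)) → (P , v) ∈ entries m
    ∈-entries P∈ v = ∈-concatMap⁺ (λ P → map (P ,_) (allVecs _ (rank P)))
      (lose P∈ (∈-map⁺ (_ ,_) (∈-allVecs v)))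

    tables : ∀ m → List (Table m)
    tables m = Valuations.valuations _≟ᵉ_ (entries m)

    -- Equality of 1-types. A type records the claims of quantified subformulas along with the
    -- atoms, so elements of equal type carry the same obligations.
    SameType : ∀ {m n} → Table m → Fin m → Table n → Fin n → Set
    SameType M i G j = All (λ P → M (P , replicate (rank P) i) ≡ G (P , replicate (rank P) j)) Ps

    SameType? : ∀ {m n} (M : Table m) i (G : Table n) j → Dec (SameType M i G j)
    SameType? M i G j = All.all? (λ P → M (P , replicate (rank P) i) Bool.≟ G (P , replicate (rank P) j)) Ps

    -- Constant assignments cover all claims, as a block has at most one free variable.
    UniversalBlocks : ∀ {m} → Table m → Set
    UniversalBlocks M = All (λ (qs , ψ) → Universal qs → ∀ i →
      eval M (const i) (block qs ψ) ≡ true → Forall M qs ψ (const i)) Bs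

    UniversalBlocks? : ∀ {m} (M : Table m) → Dec (UniversalBlocks M)
    UniversalBlocks? M = All.all? (λ (qs , ψ) →
      All.all? (_≟ᑫ univ) (quantifiers qs) →-dec Fin.all? λ i →
      (eval M (const i) (block qs ψ) Bool.≟ true) →-dec Forall? M qs ψ (const i)) Bs

    module _ {N : ℕ} (G : Table N) where

      Fits : ∀ {m} → (Fin m → Fin N) → Table m → Set
      Fits ts M = (∀ i → SameType M i G (ts i)) × UniversalBlocks M

      Fits? : ∀ {m} (ts : Fin m → Fin N) (M : Table m) → Dec (Fits ts M)
      Fits? ts M = Fin.all? (λ i → SameType? M i G (ts i)) ×-dec UniversalBlocks? M

      -- The game for a prefix after m distinct elements of the types ts have been
      -- chosen: ∀ may repeat one of them or add an element, ∃ always adds one.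
      Win : ∀ {m} → (Fin m → Fin N) → Prefix → Formula σ → (Var → Fin m) → Set
      Win ts []                ψ ρ = Any (λ M → Fits ts M × eval M ρ ψ ≡ true) (tables _)
      Win ts ((univ , x) ∷ qs) ψ ρ =
        (∀ i → Win ts qs ψ (ρ [ x ↦ i ])) ×
        (∀ t → Win (t Vector.∷ ts) qs ψ ((suc ∘ ρ) [ x ↦ zero ]))
      Win ts ((exis , x) ∷ qs) ψ ρ =
        ∃[ t ] Win (t Vector.∷ ts) qs ψ ((suc ∘ ρ) [ x ↦ zero ])

      Win? : ∀ {m} (ts : Fin m → Fin N) qs ψ ρ → Dec (Win ts qs ψ ρ)
      Win? ts [] ψ ρ = Any.any? (λ M → Fits? ts M ×-dec (eval M ρ ψ Bool.≟ true)) (tables _)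
      Win? ts ((univ , x) ∷ qs) ψ ρ =
        Fin.all? (λ i → Win? ts qs ψ _) ×-dec Fin.all? (λ t → Win? (t Vector.∷ ts) qs ψ _)
      Win? ts ((exis , x) ∷ qs) ψ ρ = Fin.any? λ t → Win? (t Vector.∷ ts) qs ψ _

      -- A play starts with one chosen element, the value of the free variable; for a closed block
      -- an arbitrary element takes its place.
      Winnable : Set
      Winnable = All (λ (qs , ψ) → ∀ t →
        eval G (const t) (block qs ψ) ≡ true → Win {1} (const t) qs ψ (const zero)) Bs

      Winnable? : Dec Winnable
      Winnable? = All.all? (λ (qs , ψ) → Fin.all? λ t →
        (eval G (const t) (block qs ψ) Bool.≟ true) →-dec Win? (const t) qs ψ (const zero)) Bs

      Certifies : Formula σ → Set
      Certifies Φ = UniversalBlocks G × Winnable × ∃[ t ] eval G (const t) Φ ≡ true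

      Certifies? : ∀ Φ → Dec (Certifies Φ)
      Certifies? Φ = UniversalBlocks? G ×-dec Winnable? ×-dec
        Fin.any? λ t → eval G (const t) Φ Bool.≟ true

    -- A model realises at most N types, since every element is described by a
    -- table of width 1.
    N : ℕ
    N = length (tables 1)

    Certificate : Formula σ → Set
    Certificate Φ = Any (λ G → Certifies G Φ) (tables N)

    Certificate? : ∀ Φ → Dec (Certificate Φ)
    Certificate? Φ = Any.any? (λ G → Certifies? G Φ) (tables N)

    -- From a model to a certificate.

    module Completeness (𝔄 : Structure σ) where

      -- A block has at most one free variable, so all variables may share the value of its only
      -- argument.
      env : ∀ {n} → Vec (Domain 𝔄) n → Var → Domain 𝔄
      env []      = const (Structure.nonempty 𝔄)
      env (a ∷ _) = const a

      Holds : (P : Predicate) → Vec (Domain 𝔄) (rank P) → Set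
      Holds (inj₁ R) v = rel 𝔄 R v
      Holds (inj₂ θ) v = 𝔄 , env v ⊨ θ

      env-fv : ∀ {m} (a : Fin m → Domain 𝔄) ρ ys → (∀ {y z} → y ∈ ys → z ∈ ys → y ≡ z) →
               ∀ {y} → y ∈ ys → env (Vec.map a (Vec.map ρ (fromList (take 1 ys)))) y ≡ a (ρ y)
      env-fv a ρ (_ ∷ _) u y∈ = cong (a ∘ ρ) (u (here refl) y∈)

      Describes : ∀ {m} → Table m → (Fin m → Domain 𝔄) → Set
      Describes M a = ∀ P → P ∈ Ps → ∀ v → M (P , v) ≡ true ⇔ Holds P (Vec.map a v)

      -- The relations of `𝔄` may be undecidable, so the table is found up to double negation.
      describe : ∀ {m} (a : Fin m → Domain 𝔄) →
                 ¬ ¬ (Σ[ M ∈ Table m ] M ∈ tables m × Describes M a)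
      describe a = ¬¬-map (λ (M , M∈ , h) → M , M∈ , λ P P∈ v → h (∈-entries P∈ v))
        (Valuations.valuation-of _≟ᵉ_ (λ (P , v) → Holds P (Vec.map a v)) (entries _))

      module _ {m} {M : Table m} {a : Fin m → Domain 𝔄} (D : Describes M a) where

        mutual
          -- A block is looked up rather than evaluated, so the recursion stops at `blk`, where
          -- coincidence passes to the constant assignment of `env`.
          eval-complete : ∀ {φ ρ ρᴬ} → Normal φ → predicates φ ⊆ Ps → (∀ x → ρᴬ x ≡ a (ρ x)) →
                          𝔄 , ρᴬ ⊨ φ → eval M ρ φ ≡ true
          eval-complete (atom {xs = xs} _) P⊆ h p = entry⁺ xs (P⊆ (here refl)) h p
          eval-complete (¬atom {xs = xs} _) P⊆ h p = ¬entry⁺ xs (P⊆ (here refl)) h p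
          eval-complete {φ ∧ᶠ ψ} (d ∧ᶠ e) P⊆ h (p , q) =
            cong₂ _∧_ (eval-complete d (P⊆ ∘ ∈-++⁺ˡ) h p)
                      (eval-complete e (P⊆ ∘ ∈-++⁺ʳ (predicates φ)) h q)
          eval-complete (d ∨ᶠ e) P⊆ h (inj₁ p) = ∨-introˡ (eval-complete d (P⊆ ∘ ∈-++⁺ˡ) h p)
          eval-complete {φ ∨ᶠ ψ} (d ∨ᶠ e) P⊆ h (inj₂ q) =
            ∨-introʳ (eval-complete e (P⊆ ∘ ∈-++⁺ʳ (predicates φ)) h q)
          eval-complete {φ} {ρ} (blk _ _ _ _ _ _ _ fv≡ _) P⊆ h p =
            from (D _ (P⊆ (here refl)) _) (coincidence 𝔄 φ
              (λ y∈ → trans (h _) (sym (env-fv a ρ (fv φ) (uniform fv≡) y∈))) p)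

          matrix-complete : ∀ {X φ ρ ρᴬ} → Matrix X φ → predicates φ ⊆ Ps → (∀ x → ρᴬ x ≡ a (ρ x)) →
                            𝔄 , ρᴬ ⊨ φ → eval M ρ φ ≡ true
          matrix-complete (normal d _) P⊆ h p = eval-complete d P⊆ h p
          matrix-complete (atom {xs = xs} _) P⊆ h p = entry⁺ xs (P⊆ (here refl)) h p
          matrix-complete (¬atom {xs = xs} _) P⊆ h p = ¬entry⁺ xs (P⊆ (here refl)) h p
          matrix-complete {φ = φ ∧ᶠ ψ} (d ∧ᶠ e) P⊆ h (p , q) =
            cong₂ _∧_ (matrix-complete d (P⊆ ∘ ∈-++⁺ˡ) h p)
                      (matrix-complete e (P⊆ ∘ ∈-++⁺ʳ (predicates φ)) h q)
          matrix-complete (d ∨ᶠ e) P⊆ h (inj₁ p) = ∨-introˡ (matrix-complete d (P⊆ ∘ ∈-++⁺ˡ) h p)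
          matrix-complete {φ = φ ∨ᶠ ψ} (d ∨ᶠ e) P⊆ h (inj₂ q) =
            ∨-introʳ (matrix-complete e (P⊆ ∘ ∈-++⁺ʳ (predicates φ)) h q)

          entry⁺ : ∀ {R ρ ρᴬ} (xs : Vec Var (arity σ R)) → inj₁ R ∈ Ps → (∀ x → ρᴬ x ≡ a (ρ x)) →
                   rel 𝔄 R (Vec.map ρᴬ xs) → M (inj₁ R , Vec.map ρ xs) ≡ true
          entry⁺ {R} {ρ} xs R∈ h p = from (D _ R∈ _)
            (subst (rel 𝔄 R) (trans (Vec.map-cong h xs) (Vec.map-∘ a ρ xs)) p)

          ¬entry⁺ : ∀ {R ρ ρᴬ} (xs : Vec Var (arity σ R)) → inj₁ R ∈ Ps → (∀ x → ρᴬ x ≡ a (ρ x)) →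
                    ¬ rel 𝔄 R (Vec.map ρᴬ xs) → not (M (inj₁ R , Vec.map ρ xs)) ≡ true
          ¬entry⁺ {R} {ρ} xs R∈ h ¬p = sym (Bool.¬-not λ e → ¬p
            (subst (rel 𝔄 R) (sym (trans (Vec.map-cong h xs) (Vec.map-∘ a ρ xs)))
              (to (D _ R∈ _) (sym e))))

      -- What completeness needs to know of a member of `Bs`, which carries no normal form: claims
      -- in a describing table are true in `𝔄`, and a true matrix evaluates to `true`.
      Reflects : Prefix × Formula σ → Set
      Reflects (qs , ψ) = ∀ {m} {M : Table m} {a} → Describes M a →
        (∀ i → eval M (const i) (block qs ψ) ≡ true → 𝔄 , const (a i) ⊨ block qs ψ) ×
        (∀ {ρ ρᴬ} → (∀ x → ρᴬ x ≡ a (ρ x)) → 𝔄 , ρᴬ ⊨ ψ → eval M ρ ψ ≡ true)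

      mutual
        reflects : ∀ {φ} (d : Normal φ) → predicates φ ⊆ Ps → All Reflects (blocks d)
        reflects (atom _)  P⊆ = []
        reflects (¬atom _) P⊆ = []
        reflects {φ ∧ᶠ _} (d ∧ᶠ e) P⊆ =
          All.++⁺ (reflects d (P⊆ ∘ ∈-++⁺ˡ)) (reflects e (P⊆ ∘ ∈-++⁺ʳ (predicates φ)))
        reflects {φ ∨ᶠ _} (d ∨ᶠ e) P⊆ =
          All.++⁺ (reflects d (P⊆ ∘ ∈-++⁺ˡ)) (reflects e (P⊆ ∘ ∈-++⁺ʳ (predicates φ)))
        reflects {φ} (blk {ψ = ψ} p qs _ _ _ _ _ fv≡ b) P⊆ =
          (λ {m} {M} {a} D →
            (λ i e → coincidence 𝔄 φ (env-fv a (const i) (fv φ) (uniform fv≡))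
                       (to (D _ (P⊆ (here refl)) _) e)) ,
            matrix-complete D b P⊆′) ∷
          reflectsᵐ b P⊆′
          where
          P⊆′ : predicates ψ ⊆ Ps
          P⊆′ = P⊆ ∘ predicates-block (p ∷ qs)

        reflectsᵐ : ∀ {X φ} (b : Matrix X φ) → predicates φ ⊆ Ps → All Reflects (blocksᵐ b)
        reflectsᵐ (normal d _) P⊆ = reflects d P⊆
        reflectsᵐ (atom _)     P⊆ = []
        reflectsᵐ (¬atom _)    P⊆ = []
        reflectsᵐ {φ = φ ∧ᶠ _} (b ∧ᶠ c) P⊆ =
          All.++⁺ (reflectsᵐ b (P⊆ ∘ ∈-++⁺ˡ)) (reflectsᵐ c (P⊆ ∘ ∈-++⁺ʳ (predicates φ)))
        reflectsᵐ {φ = φ ∨ᶠ _} (b ∨ᶠ c) P⊆ =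
          All.++⁺ (reflectsᵐ b (P⊆ ∘ ∈-++⁺ˡ)) (reflectsᵐ c (P⊆ ∘ ∈-++⁺ʳ (predicates φ)))

      Alike : Domain 𝔄 → Domain 𝔄 → Set
      Alike b c = ∀ P → P ∈ Ps → Holds P (replicate (rank P) b) ⇔ Holds P (replicate (rank P) c)

      Alike-refl : ∀ {b} → Alike b b
      Alike-refl _ _ = mk⇔ id id

      entry-replicate : ∀ {m} {M : Table m} {a} → Describes M a → ∀ {P} → P ∈ Ps → ∀ i →
                        M (P , replicate (rank P) i) ≡ true ⇔ Holds P (replicate (rank P) (a i))
      entry-replicate {M = M} {a} D {P} P∈ i =
        subst (λ v → M (P , replicate _ i) ≡ true ⇔ Holds P v) (Vec.map-replicate a i (rank P)) (D P P∈ _)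

      Alike⇒SameType : ∀ {m n} {M : Table m} {G : Table n} {a r} → Describes M a → Describes G r →
                       ∀ {i j} → Alike (a i) (r j) → SameType M i G j
      Alike⇒SameType D E s = All.tabulate λ P∈ →
        bool-ext (entry-replicate D P∈ _)
          (mk⇔ (from (s _ P∈) ∘ to (entry-replicate E P∈ _)) (from (entry-replicate E P∈ _) ∘ to (s _ P∈)))

      Represents : ∀ {n} → (Fin n → Domain 𝔄) → Set
      Represents r = ∀ b → ¬ ¬ (∃[ j ] Alike b (r j))

      -- Each table of width 1 gets an element that it describes, if there is one. Since every
      -- element is described by some such table, it is alike to the representative of that table.
      representatives : ¬ ¬ (Σ[ r ∈ (Fin N → Domain 𝔄) ] Represents r)
      representatives = do
        f ← ¬¬-∀-Fin (λ j → ¬¬-map (choose j) ¬¬-excluded-middle)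
        ¬¬-η (proj₁ ∘ f , λ b → ¬¬-map (λ (t , t∈ , D) →
          let j = Any.index t∈
              D′ = subst (λ t → Describes t (const b)) (Any.lookup-index t∈) D
              E = proj₂ (f j) b D′ in
          j , λ _ P∈ → mk⇔ (to (entry-replicate E P∈ zero) ∘ from (entry-replicate D′ P∈ zero))
                         (to (entry-replicate D′ P∈ zero) ∘ from (entry-replicate E P∈ zero)))
          (describe (const b)))
        where
        choose : ∀ j → let t = lookup (tables 1) j in Dec (∃[ a ] Describes t (const a)) →
                 Σ[ a ∈ Domain 𝔄 ] (∀ b → Describes t (const b) → Describes t (const a))
        choose j (yes (a , D)) = a , λ _ _ → D
        -- A table that describes no element gets an arbitrary one.
        choose j (no ¬D)       = Structure.nonempty 𝔄 , λ b D → ⊥-elim (¬D (b , D))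

      module _ (Bs-reflect : All Reflects Bs) where

        describes-universal : ∀ {m} {M : Table m} {a} → Describes M a → UniversalBlocks M
        describes-universal {M = M} {a} D = All.map (λ {(qs , ψ)} h u i e →
          forall-complete qs (proj₂ (h D)) u (λ _ → refl) (proj₁ (h D) i e)) Bs-reflect
          where
          forall-complete : ∀ qs {ψ} →
            (∀ {ρ ρᴬ} → (∀ x → ρᴬ x ≡ a (ρ x)) → 𝔄 , ρᴬ ⊨ ψ → eval M ρ ψ ≡ true) →
            Universal qs → ∀ {ρ ρᴬ} → (∀ x → ρᴬ x ≡ a (ρ x)) → 𝔄 , ρᴬ ⊨ block qs ψ → Forall M qs ψ ρ
          forall-complete [] e _ h p = e h p
          forall-complete ((univ , x) ∷ qs) e (refl ∷ u) h p i =
            forall-complete qs e u (update-∘ a h x refl) (p (a i))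

        module _ {G : Table N} {r} (E : Describes G r) (R : Represents r) where

          -- The strategy imitates `𝔄`: universal moves are played with representatives, existential
          -- ones with witnesses in `𝔄`. Types of witnesses and the final table exist up to double
          -- negation, which decidability of `Win` removes.
          win-complete : ∀ qs {ψ} → Reflects (qs , ψ) → ∀ {m} (a : Fin m → Domain 𝔄) {ts ρ ρᴬ} →
                         (∀ i → Alike (a i) (r (ts i))) → (∀ x → ρᴬ x ≡ a (ρ x)) →
                         𝔄 , ρᴬ ⊨ block qs ψ → Win G ts qs ψ ρ
          win-complete qs₀ {ψ} c = go qs₀
            where
            go : ∀ qs {m} (a : Fin m → Domain 𝔄) {ts ρ ρᴬ} →
                 (∀ i → Alike (a i) (r (ts i))) → (∀ x → ρᴬ x ≡ a (ρ x)) →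
                 𝔄 , ρᴬ ⊨ block qs ψ → Win G ts qs ψ ρ
            extend : ∀ qs {m} (a : Fin m → Domain 𝔄) {ts ρ ρᴬ} x b t →
                     (∀ i → Alike (a i) (r (ts i))) → Alike b (r t) → (∀ x → ρᴬ x ≡ a (ρ x)) →
                     𝔄 , ρᴬ [ x ↦ b ] ⊨ block qs ψ →
                     Win G (t Vector.∷ ts) qs ψ ((suc ∘ ρ) [ x ↦ zero ])
            go [] a {ts} {ρ} s h p = decidable-stable (Win? G ts [] ψ ρ) (¬¬-map
              (λ (M , M∈ , D) → lose M∈
                (((λ i → Alike⇒SameType D E (s i)) , describes-universal D) , proj₂ (c D) h p))
              (describe a))
            go ((univ , x) ∷ qs) a s h p =
              (λ i → go qs a s (update-∘ a h x refl) (p (a i))) ,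
              -- The element `r t` may have been chosen before; without equality, two places of a
              -- table may describe one element.
              (λ t → extend qs a x (r t) t s Alike-refl h (p (r t)))
            go ((exis , x) ∷ qs) a {ts} {ρ} s h (b , p) =
              decidable-stable (Win? G ts ((exis , x) ∷ qs) ψ ρ)
                (¬¬-map (λ (t , b~t) → t , extend qs a x b t s b~t h p) (R b))
            extend qs a x b t s b~t h =
              go qs (b Vector.∷ a) (λ { zero → b~t ; (suc i) → s i }) (update-∘ (b Vector.∷ a) h x refl)

        complete : ∀ {Φ} → Normal Φ → predicates Φ ⊆ Ps → (∀ ρ → 𝔄 , ρ ⊨ Φ) → Certificate Φ
        complete {Φ} d P⊆ p = decidable-stable (Certificate? Φ) (do
          r , R ← representatives
          G , G∈ , E ← describe r
          -- This shows that `Fin N` is inhabited; any `t` will do, as `p` covers all assignments.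
          t , _ ← R (Structure.nonempty 𝔄)
          ¬¬-η (lose G∈ (describes-universal E , 
            All.map (λ {(qs , ψ)} c t e → win-complete E R qs c (const (r t))
              (λ _ → Alike-refl) (λ _ → refl) (proj₁ (c E) t e)) Bs-reflect ,
            t , eval-complete E d P⊆ (λ _ → refl) (p (const (r t))))))

    -- Formulas with at most one free variable depend only on types.

    -- The pair `i₀`, `j₀` serves predicates of rank 0, whose vector of variables is empty.
    uniform-map : ∀ {m n k} {M : Table m} {G : Table n} {i₀ j₀ ρ ρ′} (xs : Vec Var k) → Uniform xs →
                  SameType M i₀ G j₀ → (∀ {x} → x ∈ toList xs → SameType M (ρ x) G (ρ′ x)) →
                  ∃[ i ] ∃[ j ] SameType M i G j × Vec.map ρ xs ≡ replicate k i × Vec.map ρ′ xs ≡ replicate k j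
    uniform-map []           _ s₀ _ = _ , _ , s₀ , refl , refl
    uniform-map {ρ = ρ} {ρ′} xs@(x ∷ _) u _  s = ρ x , ρ′ x , s (here refl) ,
      map-const xs (λ y∈ → cong ρ (u y∈ (here refl))) , map-const xs (λ y∈ → cong ρ′ (u y∈ (here refl)))

    sameType-map : ∀ {m n} {M : Table m} {G : Table n} {i₀ j₀ ρ ρ′ P} → P ∈ Ps →
                   (xs : Vec Var (rank P)) → Uniform xs →
                   SameType M i₀ G j₀ → (∀ {x} → x ∈ toList xs → SameType M (ρ x) G (ρ′ x)) →
                   M (P , Vec.map ρ xs) ≡ G (P , Vec.map ρ′ xs)
    sameType-map {M = M} {G} {P = P} P∈ xs u s₀ s =
      let i , j , t , eq , eq′ = uniform-map {M = M} {G} xs u s₀ s in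
      trans (cong (λ v → M (P , v)) eq) (trans (All.lookup t P∈) (cong (λ v → G (P , v)) (sym eq′)))

    ∈-take₁ : ∀ (ys : List Var) {y} → y ∈ toList (fromList (take 1 ys)) → y ∈ ys
    ∈-take₁ (_ ∷ _) (here eq) = here eq

    take₁-uniform : (ys : List Var) → Uniform (fromList (take 1 ys))
    take₁-uniform (_ ∷ _) (here refl) (here refl) = refl

    -- Each atom and each block is looked up at a constant tuple, where tables of different widths
    -- agree once the types do.
    eval-sameType : ∀ {m n} {M : Table m} {G : Table n} {i₀ j₀ ρ ρ′ φ} → Normal φ → predicates φ ⊆ Ps →
                    SameType M i₀ G j₀ → (∀ {x} → x ∈ fv φ → SameType M (ρ x) G (ρ′ x)) →
                    eval M ρ φ ≡ eval G ρ′ φ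
    eval-sameType {M = M} {G} (atom {xs = xs} u) P⊆ s₀ s =
      sameType-map {M = M} {G} (P⊆ (here refl)) xs u s₀ s
    eval-sameType {M = M} {G} (¬atom {xs = xs} u) P⊆ s₀ s =
      cong not (sameType-map {M = M} {G} (P⊆ (here refl)) xs u s₀ s)
    eval-sameType {φ = φ ∧ᶠ ψ} (d ∧ᶠ e) P⊆ s₀ s =
      cong₂ _∧_ (eval-sameType d (P⊆ ∘ ∈-++⁺ˡ) s₀ (s ∘ ∈-++⁺ˡ))
                (eval-sameType e (P⊆ ∘ ∈-++⁺ʳ (predicates φ)) s₀ (s ∘ ∈-++⁺ʳ (fv φ)))
    eval-sameType {φ = φ ∨ᶠ ψ} (d ∨ᶠ e) P⊆ s₀ s =
      cong₂ _∨_ (eval-sameType d (P⊆ ∘ ∈-++⁺ˡ) s₀ (s ∘ ∈-++⁺ˡ))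
                (eval-sameType e (P⊆ ∘ ∈-++⁺ʳ (predicates φ)) s₀ (s ∘ ∈-++⁺ʳ (fv φ)))
    eval-sameType {M = M} {G} {φ = φ} (blk _ _ _ _ _ _ _ _ _) P⊆ s₀ s =
      sameType-map {M = M} {G} (P⊆ (here refl)) (fromList (take 1 (fv φ)))
        (take₁-uniform (fv φ)) s₀ (s ∘ ∈-take₁ (fv φ))

    SameType-refl : ∀ {n} {G : Table n} {i} → SameType G i G i
    SameType-refl = All.tabulate λ _ → refl

    -- From a certificate to a model.

    module Model {n} {G : Table n} (G-universal : UniversalBlocks G) (G-winnable : Winnable G)
                 (t₀ : Fin n) where

      -- node t c es is an element of type t added when es had been chosen; c is
      -- the index of the table that describes node t c es ∷ es.
      data Element : Set where
        node : Fin n → ℕ → List Element → Element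

      type : Element → Fin n
      type (node t _ _) = t

      history scope : Element → List Element
      history (node _ _ es) = es
      scope w = w ∷ history w

      infix 4 _≟_ _≟*_

      mutual
        _≟_ : DecidableEquality Element
        node t c es ≟ node u d fs =
          map′ (λ { (refl , refl , refl) → refl }) (λ { refl → refl , refl , refl })
            ((t Fin.≟ u) ×-dec (c ℕ.≟ d) ×-dec (es ≟* fs))

        _≟*_ : DecidableEquality (List Element)
        []       ≟* []       = yes refl
        []       ≟* (_ ∷ _)  = no λ ()
        (_ ∷ _)  ≟* []       = no λ ()
        (e ∷ es) ≟* (f ∷ fs) = map′ (λ { (refl , refl) → refl }) (λ { refl → refl , refl })
          ((e ≟ f) ×-dec (es ≟* fs))

      open import Data.List.Membership.DecPropositional _≟_ using (_∈?_)

      mutual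
        size : Element → ℕ
        size (node _ _ es) = suc (sizes es)

        sizes : List Element → ℕ
        sizes []       = 0
        sizes (e ∷ es) = size e + sizes es

      size≤sizes : ∀ {e es} → e ∈ es → size e ≤ sizes es
      size≤sizes {es = e ∷ es} (here refl) = ℕ.m≤m+n (size e) (sizes es)
      size≤sizes {es = e ∷ es} (there e∈) = ℕ.≤-trans (size≤sizes e∈) (ℕ.m≤n+m (sizes es) (size e))

      size-history : ∀ w {e} → e ∈ history w → size e < size w
      size-history (node _ _ es) e∈ = s≤s (size≤sizes e∈)

      history-fresh : ∀ w {e} → e ∈ history w → w ≢ e
      history-fresh w e∈ refl = ℕ.<-irrefl refl (size-history w e∈)

      -- Otherwise each of the two terms would occur in the history of the other and be smaller in
      -- size.
      scope-antisym : ∀ {v w} → v ∈ scope w → w ∈ scope v → v ≡ w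
      scope-antisym (here v≡w) _ = v≡w
      scope-antisym (there _) (here w≡v) = sym w≡v
      scope-antisym {v} {w} (there v∈) (there w∈) =
        contradiction (size-history w v∈) (ℕ.<-asym (size-history v w∈))

      -- Charts: the table that decides the atoms on a set of elements.

      -- `place` is total for convenience; its values are meaningful on `S`.
      record Chart (S : List Element) : Set where
        field
          {width}   : ℕ
          table     : Table width
          place     : Element → Fin width
          universal : UniversalBlocks table
          faithful  : ∀ {e} → e ∈ S → SameType table (place e) G (type e)

        value : ∀ R → Vec Element (arity σ R) → Bool
        value R v = table (inj₁ R , Vec.map place v)

      open Chart

      default : ∀ {S} → Chart S
      default = record { table = G ; place = type ; universal = G-universal
                       ; faithful = λ _ → SameType-refl {G = G} }

      position : ∀ w es → Element → Fin (length (w ∷ es))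
      position w es e with e ∈? (w ∷ es)
      ... | yes e∈ = Any.index e∈
      ... | no _   = zero

      lookup-position : ∀ {w es e} → e ∈ w ∷ es → lookup (w ∷ es) (position w es e) ≡ e
      lookup-position {w} {es} {e} e∈ with e ∈? (w ∷ es)
      ... | yes e∈′ = sym (Any.lookup-index e∈′)
      ... | no e∉   = contradiction e∈ e∉

      -- Every term is an element, even one that arises in no play. If its index names no table or
      -- one that does not fit, `default` keeps the universal blocks true.
      chartFrom : ∀ w → Maybe (Table (length (scope w))) → Chart (scope w)
      chartFrom w nothing = default
      chartFrom w (just M) with Fits? G (type ∘ lookup (scope w)) M
      ... | no _ = default
      ... | yes (s , u) = record
        { table = M ; place = position w (history w) ; universal = u
        ; faithful = λ {e} e∈ → subst (λ e′ → SameType M (position w (history w) e) G (type e′))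
                                  (lookup-position e∈) (s (position w (history w) e)) }

      chart : ∀ w → Chart (scope w)
      chart w@(node _ c es) = chartFrom w (head (drop c (tables (length (w ∷ es)))))

      chart-value : ∀ {t c es M} → let w = node t c es in
                    head (drop c (tables (length (w ∷ es)))) ≡ just M →
                    Fits G (type ∘ lookup (w ∷ es)) M →
                    ∀ R v → value (chart w) R v ≡ M (inj₁ R , Vec.map (position w es) v)
      chart-value {t} {c} {es} {M} eq f R v rewrite eq
        with Fits? G (type ∘ lookup (node t c es ∷ es)) M
      ... | yes _ = refl
      ... | no ¬f = contradiction f ¬f

      -- At most one member of v has all of v in its scope (scope-antisym): the
      -- atoms on v are read off the chart of this home of v.
      Home : List Element → Set
      Home v = Any (λ w → All (_∈ scope w) v) v

      home? : ∀ v → Dec (Home v)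
      home? v = Any.any? (λ w → All.all? (_∈? scope w) v) v

      homeChart : ∀ {v} → Dec (Home v) → Chart v
      homeChart (no _) = default
      homeChart (yes h) = let w , _ , v⊆ = find h in record
        { table = table (chart w) ; place = place (chart w) ; universal = universal (chart w)
        ; faithful = λ e∈ → faithful (chart w) (All.lookup v⊆ e∈) }

      -- The home found by `find h` and `w` lie in each other's scope, so they are equal.
      homeChart-value : ∀ {v w} → w ∈ v → v ⊆ scope w → (h : Dec (Home v)) →
                        ∀ R u → value (homeChart h) R u ≡ value (chart w) R u
      homeChart-value w∈ v⊆ (no ¬h) R u = contradiction (lose w∈ (All.tabulate v⊆)) ¬h
      homeChart-value w∈ v⊆ (yes h) R u = let w′ , w′∈ , v⊆′ = find h in
        cong (λ w → value (chart w) R u) (scope-antisym (v⊆ w′∈) (All.lookup v⊆′ w∈))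

      -- Homes depend on the set of elements only, so atoms listing it in different orders or with
      -- repetitions consult the same table.
      homeChart-cong : ∀ {v v′} → v ⊆ v′ → v′ ⊆ v → (h : Dec (Home v)) (h′ : Dec (Home v′)) →
                       ∀ R u → value (homeChart h) R u ≡ value (homeChart h′) R u
      homeChart-cong v⊆ ⊆v (no _)  (no _)   R u = refl
      homeChart-cong v⊆ ⊆v (yes h) h′       R u = let w , w∈ , v⊆w = find h in
        sym (homeChart-value (v⊆ w∈) (All.lookup v⊆w ∘ ⊆v) h′ R u)
      homeChart-cong v⊆ ⊆v h       (yes h′) R u = let w , w∈ , v⊆w = find h′ in
        homeChart-value (⊆v w∈) (All.lookup v⊆w ∘ v⊆) h R u

      truth : ∀ R → Vec Element (arity σ R) → Bool
      truth R v = value (homeChart (home? (toList v))) R v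

      𝔐 : Structure σ
      𝔐 = record { Domain = Element ; nonempty = node t₀ 0 [] ; rel = λ R v → truth R v ≡ true }

      ∈-map⁻ᵛ : ∀ {k e} {ρ : Var → Element} (xs : Vec Var k) → e ∈ toList (Vec.map ρ xs) →
                ∃[ x ] x ∈ toList xs × e ≡ ρ x
      ∈-map⁻ᵛ {ρ = ρ} xs e∈ = ∈-map⁻ ρ (subst (_ ∈_) (Vec.toList-map ρ xs) e∈)

      ∈-map⁺ᵛ : ∀ {k x} {ρ : Var → Element} (xs : Vec Var k) → x ∈ toList xs →
                ρ x ∈ toList (Vec.map ρ xs)
      ∈-map⁺ᵛ {ρ = ρ} xs x∈ = subst (_ ∈_) (sym (Vec.toList-map ρ xs)) (∈-map⁺ ρ x∈)

      -- Whichever chart is consulted, it is faithful to types, and these determine atoms in one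
      -- variable.
      truth-uniform : ∀ {R ρ} (xs : Vec Var (arity σ R)) → inj₁ R ∈ Ps → Uniform xs →
                      truth R (Vec.map ρ xs) ≡ G (inj₁ R , Vec.map (type ∘ ρ) xs)
      truth-uniform {R} {ρ} xs R∈ u = value-uniform (home? _)
        where
        value-uniform : (h : Dec (Home (toList (Vec.map ρ xs)))) →
                        value (homeChart h) R (Vec.map ρ xs) ≡ G (inj₁ R , Vec.map (type ∘ ρ) xs)
        value-uniform (no _) = cong (λ v → G (inj₁ R , v)) (sym (Vec.map-∘ type ρ xs))
        value-uniform (yes h) = let C = homeChart (yes h) in
          trans (cong (λ v → table C (inj₁ R , v)) (sym (Vec.map-∘ (place C) ρ xs)))
            (sameType-map {M = table C} {G} R∈ xs u (faithful C (proj₁ (proj₂ (find h))))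
              (faithful C ∘ ∈-map⁺ᵛ xs))

      -- Soundness of blocks and of the whole formula.

      -- Agreement on types and on the atoms with variable set exactly `X` is all that a matrix over
      -- `X` can observe.
      Sound : List Var → Formula σ → Set
      Sound X ψ = ∀ {m} (M : Table m) (ρ : Var → Fin m) (ρᴱ : Var → Element) →
        (∀ {x} → x ∈ X → SameType M (ρ x) G (type (ρᴱ x))) →
        (∀ {R} (xs : Vec Var (arity σ R)) → toList xs ∼[ set ] X →
          M (inj₁ R , Vec.map ρ xs) ≡ truth R (Vec.map ρᴱ xs)) →
        eval M ρ ψ ≡ true → 𝔐 , ρᴱ ⊨ ψ

      -- Invariant of a play. Distinctness of `es` makes the place of an element in the final table
      -- unique.
      Plays : (es : List Element) → (Fin (length es) → Fin n) → (Var → Fin (length es)) → (Var → Element) → Set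
      Plays es ts ρ ρᴱ = Unique es × (∀ i → ts i ≡ type (lookup es i)) × (∀ x → ρᴱ x ≡ lookup es (ρ x))

      Plays-old : ∀ {es ts ρ ρᴱ} x {b} (b∈ : b ∈ es) → Plays es ts ρ ρᴱ →
                  Plays es ts (ρ [ x ↦ Any.index b∈ ]) (ρᴱ [ x ↦ b ])
      Plays-old {es} x b∈ (u , t , h) = u , t , update-∘ (lookup es) h x (Any.lookup-index b∈)

      Plays-new : ∀ {es ts ρ ρᴱ} x {b} → b ∉ es → Plays es ts ρ ρᴱ →
                  Plays (b ∷ es) (type b Vector.∷ ts) ((suc ∘ ρ) [ x ↦ zero ]) (ρᴱ [ x ↦ b ])
      Plays-new {es} x {b} b∉ (u , t , h) =
        All.¬Any⇒All¬ es b∉ ∷ u , (λ { zero → refl ; (suc i) → t i }) ,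
        update-∘ (lookup (b ∷ es)) h x refl

      module _ {X ψ} (ψ-sound : Sound X ψ) where

        -- The last element `w` is the value of a variable in `X`, so it occurs in each atom on all
        -- of `X`, and the other values lie in its scope. Hence `w` is the home, and its chart is
        -- the winning table `M`. Plays ending in the same term have used the same table.
        node-sound : ∀ {t c es M ts ρ ρᴱ} → let w = node t c es in ∀ {x} → x ∈ X → ρᴱ x ≡ w →
                     head (drop c (tables (length (w ∷ es)))) ≡ just M →
                     Fits G ts M → Plays (w ∷ es) ts ρ ρᴱ → eval M ρ ψ ≡ true → 𝔐 , ρᴱ ⊨ ψ
        node-sound {t} {c} {es} {M} {ts} {ρ} {ρᴱ} {x} x∈ x↦w eq (s , U) (u , ts≡ , h) =
          ψ-sound M ρ ρᴱ (λ {y} _ → subst (SameType M (ρ y) G) (trans (ts≡ (ρ y)) (cong type (sym (h y)))) (s (ρ y)))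
            λ {R} xs xs∼X → begin
              M (inj₁ R , Vec.map ρ xs)
                ≡⟨ cong (λ v → M (inj₁ R , v)) (Vec.map-cong position-ρ xs) ⟨
              M (inj₁ R , Vec.map (position w es ∘ ρᴱ) xs)
                ≡⟨ cong (λ v → M (inj₁ R , v)) (Vec.map-∘ (position w es) ρᴱ xs) ⟩
              M (inj₁ R , Vec.map (position w es) (Vec.map ρᴱ xs))
                ≡⟨ chart-value eq ((λ i → subst (SameType M i G) (ts≡ i) (s i)) , U) R (Vec.map ρᴱ xs) ⟨
              value (chart w) R (Vec.map ρᴱ xs)
                ≡⟨ homeChart-value
                     (subst (_∈ toList (Vec.map ρᴱ xs)) x↦w (∈-map⁺ᵛ xs (from xs∼X x∈)))
                     (λ e∈ → let y , _ , e≡ = ∈-map⁻ᵛ xs e∈ in subst (_∈ w ∷ es) (sym e≡) (in-scope y))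
                     (home? (toList (Vec.map ρᴱ xs))) R (Vec.map ρᴱ xs) ⟨
              truth R (Vec.map ρᴱ xs) ∎
          where
          open ≡-Reasoning
          w = node t c es

          in-scope : ∀ y → ρᴱ y ∈ w ∷ es
          in-scope y = subst (_∈ w ∷ es) (sym (h y)) (∈-lookup (ρ y))

          position-ρ : ∀ y → position w es (ρᴱ y) ≡ ρ y
          position-ρ y = lookup-injective u _ _ (trans (lookup-position (in-scope y)) (h y))

        play : ∀ {qs} → EndsInExis qs → variables qs ⊆ X →
               ∀ es {ts ρ ρᴱ} → Plays es ts ρ ρᴱ → Win G ts qs ψ ρ → 𝔐 , ρᴱ ⊨ block qs ψ
        play (last x) ⊆X es {ρᴱ = ρᴱ} P (t , win) =
          let M , M∈ , f , e = find win
              c , eq = ∈⇒nth M∈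
              w = node t c es
          in w , node-sound (⊆X (here refl)) (updated ρᴱ x w) eq f
                   (Plays-new x (λ w∈ → history-fresh w w∈ refl) P) e
        play ((exis , x) ∷ end) ⊆X es P (t , win) =
          -- The index 0 is arbitrary: the atoms on all of `X` also contain the element added last,
          -- which is their home.
          let w = node t 0 es in
          w , play end (⊆X ∘ there) (w ∷ es)
                (Plays-new x (λ w∈ → history-fresh w w∈ refl) P) win
        play ((univ , x) ∷ end) ⊆X es P (old , new) b with b ∈? es
        ... | yes b∈ = play end (⊆X ∘ there) es (Plays-old x b∈ P) (old (Any.index b∈))
        ... | no b∉  = play end (⊆X ∘ there) (b ∷ es) (Plays-new x b∉ P) (new (type b))

      module _ {X ψ x₀} (qs : Prefix) (θ-normal : Normal (block qs ψ))
               (P⊆ : predicates (block qs ψ) ⊆ Ps) (θ∈ : (qs , ψ) ∈ Bs) (x₀∈ : x₀ ∈ X)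
               (fv≡ : ∀ {y} → y ∈ fv (block qs ψ) → y ≡ x₀ × y ∉ variables qs)
               (ψ-sound : Sound X ψ) where

        -- Let `M` be the table of the home chart for the values of `X`. The claim depends only on a
        -- type, so it passes from `G` to `M`; there it holds by `UniversalBlocks`, and the atoms on
        -- all of `X` are read off this very chart.
        universal-sound : Universal qs → X ⊆ x₀ ∷ variables qs →
                          ∀ {ρ} → eval G (type ∘ ρ) (block qs ψ) ≡ true → 𝔐 , ρ ⊨ block qs ψ
        universal-sound u X⊆ {ρ} claim = forall-intro 𝔐 qs u λ ρ′ ρ′≡ρ →
          let v = map ρ′ X
              C = homeChart (home? v)
              M = table C
              i = place C (ρ′ x₀)
              s : ∀ {x} → x ∈ X → SameType M (place C (ρ′ x)) G (type (ρ′ x))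
              s = λ x∈ → faithful C (∈-map⁺ ρ′ x∈)
              claimᴹ : eval M (const i) (block qs ψ) ≡ true
              claimᴹ = trans (eval-sameType {M = M} {G} θ-normal P⊆ (s x₀∈) (λ y∈ →
                let y≡x₀ , y∉ = fv≡ y∈ in
                subst (SameType M i G ∘ type)
                  (trans (cong ρ′ (sym y≡x₀)) (ρ′≡ρ y∉)) (s x₀∈))) claim
              ρᴹ = assign (const i) qs (place C ∘ ρ′)
              ρᴹ≡ : ∀ {x} → x ∈ X → ρᴹ x ≡ place C (ρ′ x)
              ρᴹ≡ = λ x∈ → assign-≡ qs (place C ∘ ρ′) (value-at ρ′ (place C) (X⊆ x∈))
          in ψ-sound M ρᴹ ρ′
               (λ {x} x∈ → subst (λ j → SameType M j G (type (ρ′ x))) (sym (ρᴹ≡ x∈)) (s x∈))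
               (λ {R} xs xs∼X → begin
                 M (inj₁ R , Vec.map ρᴹ xs)
                   ≡⟨ cong (λ v → M (inj₁ R , v)) (map-cong-∈ xs (ρᴹ≡ ∘ to xs∼X)) ⟩
                 M (inj₁ R , Vec.map (place C ∘ ρ′) xs)
                   ≡⟨ cong (λ v → M (inj₁ R , v)) (Vec.map-∘ (place C) ρ′ xs) ⟩
                 value C R (Vec.map ρ′ xs)
                   ≡⟨ homeChart-cong
                        (λ e∈ → let y , y∈ , e≡ = ∈-map⁻ ρ′ e∈ in
                          subst (_∈ toList (Vec.map ρ′ xs)) (sym e≡) (∈-map⁺ᵛ xs (from xs∼X y∈)))
                        (λ e∈ → let y , y∈ , e≡ = ∈-map⁻ᵛ xs e∈ in
                          subst (_∈ v) (sym e≡) (∈-map⁺ ρ′ (to xs∼X y∈)))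
                        (home? v) (home? (toList (Vec.map ρ′ xs))) R (Vec.map ρ′ xs) ⟩
                 truth R (Vec.map ρ′ xs) ∎)
               (forall-elim qs (All.lookup (universal C) θ∈ u i claimᴹ) (place C ∘ ρ′))
          where
          open ≡-Reasoning

          value-at : ∀ {A B : Set} (f : Var → A) (g : A → B) {y} → y ∈ x₀ ∷ variables qs →
                     y ∈ variables qs ⊎ g (f x₀) ≡ g (f y)
          value-at f g (here refl) = inj₂ refl
          value-at f g (there y∈)  = inj₁ y∈

        -- Only `x₀` can be free, so the assignment may be replaced by the constant one with value
        -- `ρ x₀`, from which the play starts.
        existential-sound : EndsInExis qs → variables qs ⊆ X →
                            ∀ {ρ} → eval G (type ∘ ρ) (block qs ψ) ≡ true → 𝔐 , ρ ⊨ block qs ψ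
        existential-sound end ⊆X {ρ} claim =
          coincidence 𝔐 (block qs ψ) (λ y∈ → cong ρ (sym (proj₁ (fv≡ y∈))))
            (play ψ-sound end ⊆X (e₀ ∷ []) ([] ∷ [] , (λ { zero → refl }) , λ _ → refl)
              (All.lookup G-winnable θ∈ (type e₀) claim₀))
          where
          e₀ = ρ x₀

          claim₀ : eval G (const (type e₀)) (block qs ψ) ≡ true
          claim₀ = trans (eval-sameType {M = G} {G} θ-normal P⊆ (SameType-refl {G = G} {type e₀})
            (λ y∈ → subst (SameType G (type e₀) G ∘ type) (cong ρ (sym (proj₁ (fv≡ y∈))))
              (SameType-refl {G = G}))) claim

      mutual
        -- In negation normal form claims of blocks occur positively, so it is enough that claims
        -- made in `G` come true.
        sound : ∀ {φ} (d : Normal φ) → predicates φ ⊆ Ps → blocks d ⊆ Bs →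
                ∀ {ρ} → eval G (type ∘ ρ) φ ≡ true → 𝔐 , ρ ⊨ φ
        sound (atom {xs = xs} u) P⊆ B⊆ e = trans (truth-uniform xs (P⊆ (here refl)) u) e
        sound (¬atom {xs = xs} u) P⊆ B⊆ e p =
          not-true e (trans (sym (truth-uniform xs (P⊆ (here refl)) u)) p)
        sound {φ ∧ᶠ ψ} (d ∧ᶠ e) P⊆ B⊆ t = let t₁ , t₂ = ∧-true t in
          sound d (P⊆ ∘ ∈-++⁺ˡ) (B⊆ ∘ ∈-++⁺ˡ) t₁ ,
          sound e (P⊆ ∘ ∈-++⁺ʳ (predicates φ)) (B⊆ ∘ ∈-++⁺ʳ (blocks d)) t₂
        sound {φ ∨ᶠ ψ} (d ∨ᶠ e) P⊆ B⊆ t with ∨-true t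
        ... | inj₁ t₁ = inj₁ (sound d (P⊆ ∘ ∈-++⁺ˡ) (B⊆ ∘ ∈-++⁺ˡ) t₁)
        ... | inj₂ t₂ = inj₂ (sound e (P⊆ ∘ ∈-++⁺ʳ (predicates φ)) (B⊆ ∘ ∈-++⁺ʳ (blocks d)) t₂)
        sound d@(blk p qs x₀ (inj₁ u) x₀∈ ⊆X X⊆ fv≡ b) P⊆ B⊆ =
          universal-sound (p ∷ qs) d P⊆ (B⊆ (here refl)) x₀∈ fv≡
            (matrix-sound b (P⊆ ∘ predicates-block (p ∷ qs)) (B⊆ ∘ there) x₀∈) u X⊆
        sound d@(blk p qs x₀ (inj₂ l) x₀∈ ⊆X X⊆ fv≡ b) P⊆ B⊆ =
          existential-sound (p ∷ qs) d P⊆ (B⊆ (here refl)) x₀∈ fv≡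
            (matrix-sound b (P⊆ ∘ predicates-block (p ∷ qs)) (B⊆ ∘ there) x₀∈)
            (endsInExis (p ∷ qs) l) ⊆X

        matrix-sound : ∀ {X ψ x₀} (b : Matrix X ψ) → predicates ψ ⊆ Ps → blocksᵐ b ⊆ Bs →
                       x₀ ∈ X → Sound X ψ
        -- A nested `Normal` formula depends only on types, so its value in `M` is the one in `G`,
        -- and the induction returns to `sound`.
        matrix-sound (normal d fv⊆X) P⊆ B⊆ x₀∈ M ρ ρᴱ s full e =
          sound d P⊆ B⊆ (trans (sym (eval-sameType {M = M} {G} d P⊆ (s x₀∈) (s ∘ fv⊆X))) e)
        matrix-sound (atom {xs = xs} xs∼X) P⊆ B⊆ x₀∈ M ρ ρᴱ s full e = trans (sym (full xs xs∼X)) e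
        matrix-sound (¬atom {xs = xs} xs∼X) P⊆ B⊆ x₀∈ M ρ ρᴱ s full e p =
          not-true e (trans (full xs xs∼X) p)
        matrix-sound {ψ = φ ∧ᶠ ψ} (b ∧ᶠ c) P⊆ B⊆ x₀∈ M ρ ρᴱ s full e = let e₁ , e₂ = ∧-true e in
          matrix-sound b (P⊆ ∘ ∈-++⁺ˡ) (B⊆ ∘ ∈-++⁺ˡ) x₀∈ M ρ ρᴱ s full e₁ ,
          matrix-sound c (P⊆ ∘ ∈-++⁺ʳ (predicates φ)) (B⊆ ∘ ∈-++⁺ʳ (blocksᵐ b)) x₀∈ M ρ ρᴱ s full e₂
        matrix-sound {ψ = φ ∨ᶠ ψ} (b ∨ᶠ c) P⊆ B⊆ x₀∈ M ρ ρᴱ s full e with ∨-true e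
        ... | inj₁ e₁ = inj₁ (matrix-sound b (P⊆ ∘ ∈-++⁺ˡ) (B⊆ ∘ ∈-++⁺ˡ) x₀∈ M ρ ρᴱ s full e₁)
        ... | inj₂ e₂ = inj₂ (matrix-sound c (P⊆ ∘ ∈-++⁺ʳ (predicates φ)) (B⊆ ∘ ∈-++⁺ʳ (blocksᵐ b))
                               x₀∈ M ρ ρᴱ s full e₂)

    -- Decidability of satisfiability.

    certificate-sound : ∀ {Φ} → Sentence Φ → (d : Normal Φ) → predicates Φ ⊆ Ps → blocks d ⊆ Bs →
                        Certificate Φ → Satisfiable Φ
    certificate-sound {Φ} fv≡[] d P⊆ B⊆ C =
      let G , _ , U , W , t , e = find C
          open Model {G = G} U W t
      in 𝔐 , λ ρ → coincidence 𝔐 Φ (λ y∈ → ∉-[] (subst (_ ∈_) fv≡[] y∈))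
                      -- Any element of type `t` would do, since a sentence holds under one
                      -- assignment if and only if it holds under all.
                      (sound d P⊆ B⊆ {ρ = const (node t 0 [])} e)
      where
      ∉-[] : ∀ {A B : Set} {x : A} → x ∈ [] → B
      ∉-[] ()

theorem3 : (σ : Signature) (φ : Formula σ) →
    Sentence φ → AUF₁⁻ φ → Dec (Satisfiable φ)
theorem3 σ φ fv≡[] (n , d , a) = map′ (certificate-sound fv≡[] D id id)
  (λ (𝔄 , p) → let open Completeness 𝔄 in complete (reflects D id) D id p) (Certificate? φ)
  where
  D = normalise d n a
  open Certificates (predicates φ) (blocks D)
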